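{- Let $p$ be a prime, let $g$ be the genus of $Y_0(p)$, let $V_p=H_1(Y_0(p),\mathbb{R})\cong\mathbb{R}^{2g+1}$, and let $B=\{v_0,\dots,v_{2g}\}$ be a basis of $V_p$. Let $$\mathcal{L}(x_0,\dots,x_n)=\left\{\sum_{0\leq i\leq n}a_{ik}x_i+\sum_{0\leq j\leq2g}b_{jk}v_j=0\right\}_{0\leq k\leq K}$$ be a system of linear equations in $V_p$ (in the variables $x_0,\dots,x_n$) satisfying: (1) $\mathcal{L}$ has exactly one solution $(x_0,\dots,x_n)\in (V_p)^{n+1}$; (2) for any subset $A\subset\{0,\dots,K\}$, any $0\leq i\leq n$ and any $0\leq j\leq2g$, we have $\sum_{k\in A}a_{ik}\in\{ -1,0,1\}$ and $\sum_{k\in A}b_{jk}\in\{ -1,0,1\}$. Then the unique solution $(x_0,\dots,x_n)\in (V_p)^{n+1}$ satisfies $$x_i=\sum_{0\leq j\leq2g}c_{ij}v_j,\qquad c_{ij}\in\{ -1,0,1\},$$ for all $0\leq i\leq n$.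
   Context: $\Gamma_0(p)\leq\mathrm{PSL}_2(\mathbb{Z})$ is the image of the matrices with lower left entry divisible by $p$, acting on the upper half-plane $\mathbb{H}$, and $Y_0(p)=\Gamma_0(p)\backslash\mathbb{H}$ is the (non-compact) modular curve of prime level $p$; its first real homology $V_p$ has dimension $2g+1$. In the paper's setup the basis $B$ consists of homology classes of side pairing transformations of a fundamental polygon of $\Gamma_0(p)$ (under $\gamma\mapsto$ class of the geodesic from $z$ to $\gamma z$). -}

module Defs where

open import Algebra.Bundles using (CommutativeRing)
import Algebra.Properties.AbelianGroup as AbelianGroup
import Algebra.Properties.Semiring.Exp as Exponent
import Algebra.Properties.CommutativeMonoid.Sum as Sum
open import Algebra.Module.Bundles using (Module)
open import Algebra.Module.Structures.Biased using (IsModuleFromLeft)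
open import Algebra.Structures using (IsCommutativeRing)
open import Data.Bool.Base using (if_then_else_)
open import Data.Fin.Base using (Fin; zero; suc; toℕ)
open import Data.Fin.Subset using (Subset)
open import Data.Integer.Base as ℤ using (ℤ; +_)
open import Data.Integer.Coprimality using (Coprime)
open import Data.Integer.Divisibility using (_∣_)
open import Data.Nat.Base as ℕ using (ℕ; zero; suc)
import Data.Nat.Properties as ℕ
open import Data.Product using (Σ; ∃; _×_; _,_; proj₁; proj₂)
open import Data.Rational.Base as ℚ using (ℚ; 0ℚ; 1ℚ; ½; ∣_∣)
import Data.Rational.Properties as ℚ
open import Data.Rational.Solver using (module +-*-Solver)
open import Data.Sum.Base using (_⊎_; inj₁; inj₂)
open import Data.Sum.Relation.Binary.Pointwise using (_⊎ₛ_)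
open import Data.Vec.Base using (lookup)
open import Data.Vec.Functional using (insertAt)
open import Function.Base using (_∘_)
open import Level using (Level; 0ℓ; _⊔_) renaming (suc to lsuc)
open import Relation.Binary.Bundles using (Setoid)
open import Relation.Binary.Core using (Rel)
open import Relation.Binary.Definitions using (_Respects_)
import Relation.Binary.Construct.Closure.Equivalence as EqClosure
open import Relation.Binary.PropositionalEquality as ≡ using (_≡_; refl)
open import Relation.Binary.Structures using (IsEquivalence)
open import Relation.Nullary.Negation using (¬_)
import Relation.Binary.Reasoning.Setoid as SetoidReasoning

private variable
  m ℓ ℓ′ s : Level
  n : ℕ

Eventually : (ℕ → Set) → Set
Eventually P = ∃ λ N → ∀ n → N ℕ.≤ n → P n

-- A real number is a Cauchy sequence of rationals; two of them are the same
-- number when they are related by _≈_, which is coarser than _≡_.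

record ℝ : Set where
  field
    seq    : ℕ → ℚ
    cauchy : ∀ ε → 0ℚ ℚ.< ε → ∃ λ N → ∀ m n → N ℕ.≤ m → N ℕ.≤ n →
             ∣ seq m ℚ.- seq n ∣ ℚ.< ε

open ℝ

infix 4 _≈_ _<_ _≤_

_≈_ : Rel ℝ 0ℓ
x ≈ y = ∀ ε → 0ℚ ℚ.< ε → Eventually λ n → ∣ seq x n ℚ.- seq y n ∣ ℚ.< ε

_<_ : Rel ℝ 0ℓ
x < y = ∃ λ ε → 0ℚ ℚ.< ε × Eventually λ n → seq x n ℚ.+ ε ℚ.≤ seq y n

_≤_ : Rel ℝ 0ℓ
x ≤ y = ¬ (y < x)

private

  both : ∀ {P Q : ℕ → Set} → Eventually P → Eventually Q →
         Eventually λ n → P n × Q n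
  both (M , p) (N , q) = M ℕ.⊔ N , λ n h →
    p n (ℕ.≤-trans (ℕ.m≤m⊔n M N) h) , q n (ℕ.≤-trans (ℕ.m≤n⊔m M N) h)

  always : ∀ {P : ℕ → Set} → (∀ n → P n) → Eventually P
  always p = 0 , λ n _ → p n

  eventually-map : ∀ {P Q : ℕ → Set} → (∀ {n} → P n → Q n) →
                   Eventually P → Eventually Q
  eventually-map f (N , p) = N , λ n h → f (p n h)

  pos-* : ∀ {p q} → 0ℚ ℚ.< p → 0ℚ ℚ.< q → 0ℚ ℚ.< p ℚ.* q
  pos-* {p} {q} 0<p 0<q = ℚ.positive⁻¹ _
    {{ℚ.pos*pos⇒pos p {{ℚ.positive 0<p}} q {{ℚ.positive 0<q}}}}

  halve : ∀ ε → 0ℚ ℚ.< ε → ∃ λ δ → 0ℚ ℚ.< δ × δ ℚ.+ δ ≡ ε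
  halve ε 0<ε = ½ ℚ.* ε , pos-* (ℚ.positive⁻¹ ½) 0<ε ,
    ≡.trans (≡.sym (ℚ.*-distribʳ-+ ε ½ ½)) (ℚ.*-identityˡ ε)

  divide : ∀ B → 0ℚ ℚ.< B → ∀ ε → 0ℚ ℚ.< ε → ∃ λ δ → 0ℚ ℚ.< δ × B ℚ.* δ ≡ ε
  divide B 0<B ε 0<ε = B⁻¹ ℚ.* ε , pos-* 0<B⁻¹ 0<ε ,
    ≡.trans (≡.sym (ℚ.*-assoc B B⁻¹ ε))
      (≡.trans (≡.cong (ℚ._* ε) (ℚ.*-inverseʳ B)) (ℚ.*-identityˡ ε))
    where
    instance
      B-positive = ℚ.positive 0<B
      B-nonZero  = ℚ.pos⇒nonZero B
    B⁻¹ = ℚ.1/ B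
    0<B⁻¹ = ℚ.positive⁻¹ B⁻¹ {{ℚ.1/pos⇒pos B}}

  dist-≡ : ∀ {p q ε} → p ≡ q → 0ℚ ℚ.< ε → ∣ p ℚ.- q ∣ ℚ.< ε
  dist-≡ {p} refl 0<ε = ≡.subst (λ r → ∣ r ∣ ℚ.< _) (≡.sym (ℚ.+-inverseʳ p)) 0<ε

  dist-sym : ∀ p q {ε} → ∣ p ℚ.- q ∣ ℚ.< ε → ∣ q ℚ.- p ∣ ℚ.< ε
  dist-sym p q = ≡.subst (ℚ._< _) (≡.trans (≡.sym (ℚ.∣-p∣≡∣p∣ (p ℚ.- q)))
    (≡.cong ∣_∣ (solve 2 (λ p q → :- (p :- q) := q :- p) refl p q)))
    where open +-*-Solver

  dist-sum : ∀ r p q {δ η} → r ≡ p ℚ.+ q → ∣ p ∣ ℚ.< δ → ∣ q ∣ ℚ.< η →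
             ∣ r ∣ ℚ.< δ ℚ.+ η
  dist-sum _ p q refl p<δ q<η =
    ℚ.≤-<-trans (ℚ.∣p+q∣≤∣p∣+∣q∣ p q) (ℚ.+-mono-< p<δ q<η)

  dist-+ : ∀ p q p′ q′ {δ η} → ∣ p ℚ.- p′ ∣ ℚ.< δ → ∣ q ℚ.- q′ ∣ ℚ.< η →
           ∣ (p ℚ.+ q) ℚ.- (p′ ℚ.+ q′) ∣ ℚ.< δ ℚ.+ η
  dist-+ p q p′ q′ = dist-sum _ (p ℚ.- p′) (q ℚ.- q′)
    (solve 4 (λ p q p′ q′ → (p :+ q) :- (p′ :+ q′) := (p :- p′) :+ (q :- q′))
      refl p q p′ q′)
    where open +-*-Solver

  dist-neg : ∀ p q {ε} → ∣ p ℚ.- q ∣ ℚ.< ε → ∣ (ℚ.- p) ℚ.- (ℚ.- q) ∣ ℚ.< ε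
  dist-neg p q = ≡.subst (ℚ._< _) (≡.trans (≡.sym (ℚ.∣-p∣≡∣p∣ (p ℚ.- q)))
    (≡.cong ∣_∣ (solve 2 (λ p q → :- (p :- q) := (:- p) :- (:- q)) refl p q)))
    where open +-*-Solver

  abs-* : ∀ B δ p q → 0ℚ ℚ.< B → ∣ p ∣ ℚ.< B → ∣ q ∣ ℚ.< δ →
          ∣ p ℚ.* q ∣ ℚ.< B ℚ.* δ
  abs-* B δ p q 0<B p<B q<δ = begin-strict
    ∣ p ℚ.* q ∣       ≡⟨ ℚ.∣p*q∣≡∣p∣*∣q∣ p q ⟩
    ∣ p ∣ ℚ.* ∣ q ∣   ≤⟨ ℚ.*-monoʳ-≤-nonNeg ∣ q ∣ {{ℚ.∣-∣-nonNeg q}} (ℚ.<⇒≤ p<B) ⟩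
    B ℚ.* ∣ q ∣       <⟨ ℚ.*-monoʳ-<-pos B {{ℚ.positive 0<B}} q<δ ⟩
    B ℚ.* δ           ∎
    where open ℚ.≤-Reasoning

  dist-* : ∀ B δ p q p′ q′ → 0ℚ ℚ.< B → ∣ p ∣ ℚ.< B → ∣ q′ ∣ ℚ.< B →
           ∣ p ℚ.- p′ ∣ ℚ.< δ → ∣ q ℚ.- q′ ∣ ℚ.< δ →
           ∣ p ℚ.* q ℚ.- p′ ℚ.* q′ ∣ ℚ.< B ℚ.* δ ℚ.+ B ℚ.* δ
  dist-* B δ p q p′ q′ 0<B p<B q′<B dp dq =
    dist-sum _ (p ℚ.* (q ℚ.- q′)) (q′ ℚ.* (p ℚ.- p′))
      (solve 4 (λ p q p′ q′ → p :* q :- p′ :* q′ :=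
                              p :* (q :- q′) :+ q′ :* (p :- p′)) refl p q p′ q′)
      (abs-* B δ p (q ℚ.- q′) 0<B p<B dq)
      (abs-* B δ q′ (p ℚ.- p′) 0<B q′<B dp)
    where open +-*-Solver

  bounded : ∀ x → ∃ λ B → 0ℚ ℚ.< B × Eventually λ n → ∣ seq x n ∣ ℚ.< B
  bounded x = B , ℚ.+-mono-<-≤ (ℚ.positive⁻¹ 1ℚ) (ℚ.0≤∣p∣ (seq x N)) , N , λ n N≤n →
    ℚ.≤-<-trans
      (≡.subst (λ r → ∣ r ∣ ℚ.≤ ∣ seq x n ℚ.- seq x N ∣ ℚ.+ ∣ seq x N ∣)
        (solve 2 (λ p q → (p :- q) :+ q := p) refl (seq x n) (seq x N))
        (ℚ.∣p+q∣≤∣p∣+∣q∣ (seq x n ℚ.- seq x N) (seq x N)))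
      (ℚ.+-monoˡ-< ∣ seq x N ∣ (proj₂ (cauchy x 1ℚ (ℚ.positive⁻¹ 1ℚ)) n N N≤n ℕ.≤-refl))
    where
    open +-*-Solver
    N = proj₁ (cauchy x 1ℚ (ℚ.positive⁻¹ 1ℚ))
    B = 1ℚ ℚ.+ ∣ seq x N ∣

  commonBound : ∀ x y → ∃ λ B → 0ℚ ℚ.< B ×
                Eventually λ n → ∣ seq x n ∣ ℚ.< B × ∣ seq y n ∣ ℚ.< B
  commonBound x y = combine (bounded x) (bounded y)
    where
    Bound : ℝ → Set
    Bound z = ∃ λ B → 0ℚ ℚ.< B × Eventually λ n → ∣ seq z n ∣ ℚ.< B
    combine : Bound x → Bound y → ∃ λ B → 0ℚ ℚ.< B ×
              Eventually λ n → ∣ seq x n ∣ ℚ.< B × ∣ seq y n ∣ ℚ.< B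
    combine (Bx , 0<Bx , ex) (By , 0<By , ey) =
      Bx ℚ.+ By , ℚ.+-mono-< 0<Bx 0<By , eventually-map (λ {n} → weaken {n}) (both ex ey)
      where
      weaken : ∀ {n} → ∣ seq x n ∣ ℚ.< Bx × ∣ seq y n ∣ ℚ.< By →
               ∣ seq x n ∣ ℚ.< Bx ℚ.+ By × ∣ seq y n ∣ ℚ.< Bx ℚ.+ By
      weaken {n} (hx , hy) =
        ≡.subst (ℚ._< Bx ℚ.+ By) (ℚ.+-identityʳ ∣ seq x n ∣) (ℚ.+-mono-< hx 0<By) ,
        ≡.subst (ℚ._< Bx ℚ.+ By) (ℚ.+-identityˡ ∣ seq y n ∣) (ℚ.+-mono-< 0<Bx hy)

  CauchyAt : (ℕ → ℚ) → ℚ → Set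
  CauchyAt u ε = ∃ λ N → ∀ m n → N ℕ.≤ m → N ℕ.≤ n → ∣ u m ℚ.- u n ∣ ℚ.< ε

  cauchy-+ : ∀ x y ε → 0ℚ ℚ.< ε → CauchyAt (λ n → seq x n ℚ.+ seq y n) ε
  cauchy-+ x y ε 0<ε = step (halve ε 0<ε)
    where
    combine : ∀ {δ} → CauchyAt (seq x) δ → CauchyAt (seq y) δ →
              CauchyAt (λ n → seq x n ℚ.+ seq y n) (δ ℚ.+ δ)
    combine (M , p) (N , q) = M ℕ.⊔ N , λ m n hm hn →
      dist-+ (seq x m) (seq y m) (seq x n) (seq y n)
        (p m n (ℕ.≤-trans (ℕ.m≤m⊔n M N) hm) (ℕ.≤-trans (ℕ.m≤m⊔n M N) hn))
        (q m n (ℕ.≤-trans (ℕ.m≤n⊔m M N) hm) (ℕ.≤-trans (ℕ.m≤n⊔m M N) hn))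
    step : ∀ {ε} → (∃ λ δ → 0ℚ ℚ.< δ × δ ℚ.+ δ ≡ ε) →
           CauchyAt (λ n → seq x n ℚ.+ seq y n) ε
    step (δ , 0<δ , refl) = combine (cauchy x δ 0<δ) (cauchy y δ 0<δ)

  cauchy-* : ∀ x y ε → 0ℚ ℚ.< ε → CauchyAt (λ n → seq x n ℚ.* seq y n) ε
  cauchy-* x y ε 0<ε = step (halve ε 0<ε) (commonBound x y)
    where
    Bound : ℚ → Set
    Bound B = Eventually λ n → ∣ seq x n ∣ ℚ.< B × ∣ seq y n ∣ ℚ.< B
    combine : ∀ B {δ} → 0ℚ ℚ.< B → Bound B → CauchyAt (seq x) δ → CauchyAt (seq y) δ →
              CauchyAt (λ n → seq x n ℚ.* seq y n) (B ℚ.* δ ℚ.+ B ℚ.* δ)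
    combine B {δ} 0<B (L , bd) (M , p) (N , q) = L ℕ.⊔ (M ℕ.⊔ N) , λ m n hm hn →
      dist-* B δ (seq x m) (seq y m) (seq x n) (seq y n) 0<B
        (proj₁ (bd m (l hm))) (proj₂ (bd n (l hn)))
        (p m n (ℕ.≤-trans (ℕ.m≤m⊔n M N) (r hm)) (ℕ.≤-trans (ℕ.m≤m⊔n M N) (r hn)))
        (q m n (ℕ.≤-trans (ℕ.m≤n⊔m M N) (r hm)) (ℕ.≤-trans (ℕ.m≤n⊔m M N) (r hn)))
      where
      l : ∀ {k} → L ℕ.⊔ (M ℕ.⊔ N) ℕ.≤ k → L ℕ.≤ k
      l = ℕ.≤-trans (ℕ.m≤m⊔n L (M ℕ.⊔ N))
      r : ∀ {k} → L ℕ.⊔ (M ℕ.⊔ N) ℕ.≤ k → M ℕ.⊔ N ℕ.≤ k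
      r = ℕ.≤-trans (ℕ.m≤n⊔m L (M ℕ.⊔ N))
    step′ : ∀ B {η} → 0ℚ ℚ.< B → Bound B → (∃ λ δ → 0ℚ ℚ.< δ × B ℚ.* δ ≡ η) →
            CauchyAt (λ n → seq x n ℚ.* seq y n) (η ℚ.+ η)
    step′ B 0<B bd (δ , 0<δ , refl) = combine B 0<B bd (cauchy x δ 0<δ) (cauchy y δ 0<δ)
    step : ∀ {ε} → (∃ λ η → 0ℚ ℚ.< η × η ℚ.+ η ≡ ε) → (∃ λ B → 0ℚ ℚ.< B × Bound B) →
           CauchyAt (λ n → seq x n ℚ.* seq y n) ε
    step (η , 0<η , refl) (B , 0<B , bd) = step′ B 0<B bd (divide B 0<B η 0<η)

infixl 6 _+_ _-_
infixl 7 _*_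
infix  8 -_

_+_ : ℝ → ℝ → ℝ
x + y = record { seq = λ n → seq x n ℚ.+ seq y n ; cauchy = cauchy-+ x y }

_*_ : ℝ → ℝ → ℝ
x * y = record { seq = λ n → seq x n ℚ.* seq y n ; cauchy = cauchy-* x y }

-_ : ℝ → ℝ
- x = record
  { seq    = λ n → ℚ.- seq x n
  ; cauchy = λ ε 0<ε → proj₁ (cauchy x ε 0<ε) , λ m n hm hn →
      dist-neg (seq x m) (seq x n) (proj₂ (cauchy x ε 0<ε) m n hm hn)
  }

_-_ : ℝ → ℝ → ℝ
x - y = x + - y

fromℚ : ℚ → ℝ
fromℚ q = record { seq = λ _ → q ; cauchy = λ _ 0<ε → 0 , λ _ _ _ _ → dist-≡ {q} refl 0<ε }

fromℤ : ℤ → ℝ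
fromℤ z = fromℚ (z ℚ./ 1)

0ℝ 1ℝ : ℝ
0ℝ = fromℚ 0ℚ
1ℝ = fromℚ 1ℚ

private

  pointwise : ∀ x y → (∀ n → seq x n ≡ seq y n) → x ≈ y
  pointwise x y eq ε 0<ε = always λ n → dist-≡ (eq n) 0<ε

  ≈-sym : ∀ {x y} → x ≈ y → y ≈ x
  ≈-sym {x} {y} x≈y ε 0<ε =
    eventually-map (λ {n} → dist-sym (seq x n) (seq y n)) (x≈y ε 0<ε)

  Close : (u v : ℕ → ℚ) → ℚ → Set
  Close u v ε = Eventually λ n → ∣ u n ℚ.- v n ∣ ℚ.< ε

  ≈-trans : ∀ {x y z} → x ≈ y → y ≈ z → x ≈ z
  ≈-trans {x} {y} {z} x≈y y≈z ε 0<ε = step (halve ε 0<ε)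
    where
    open +-*-Solver
    step : ∀ {ε} → (∃ λ δ → 0ℚ ℚ.< δ × δ ℚ.+ δ ≡ ε) → Close (seq x) (seq z) ε
    step (δ , 0<δ , refl) = eventually-map
      (λ {n} (p , q) → dist-sum _ (seq x n ℚ.- seq y n) (seq y n ℚ.- seq z n)
        (solve 3 (λ a b c → a :- c := (a :- b) :+ (b :- c)) refl (seq x n) (seq y n) (seq z n))
        p q)
      (both (x≈y δ 0<δ) (y≈z δ 0<δ))

  +-cong : ∀ {x x′ y y′} → x ≈ x′ → y ≈ y′ → x + y ≈ x′ + y′
  +-cong {x} {x′} {y} {y′} x≈x′ y≈y′ ε 0<ε = step (halve ε 0<ε)
    where
    step : ∀ {ε} → (∃ λ δ → 0ℚ ℚ.< δ × δ ℚ.+ δ ≡ ε) → Close (seq (x + y)) (seq (x′ + y′)) ε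
    step (δ , 0<δ , refl) = eventually-map
      (λ {n} (p , q) → dist-+ (seq x n) (seq y n) (seq x′ n) (seq y′ n) p q)
      (both (x≈x′ δ 0<δ) (y≈y′ δ 0<δ))

  -‿cong : ∀ {x y} → x ≈ y → - x ≈ - y
  -‿cong {x} {y} x≈y ε 0<ε =
    eventually-map (λ {n} → dist-neg (seq x n) (seq y n)) (x≈y ε 0<ε)

  *-cong : ∀ {x x′ y y′} → x ≈ x′ → y ≈ y′ → x * y ≈ x′ * y′
  *-cong {x} {x′} {y} {y′} x≈x′ y≈y′ ε 0<ε = step (halve ε 0<ε) (commonBound x y′)
    where
    Bound : ℚ → Set
    Bound B = Eventually λ n → ∣ seq x n ∣ ℚ.< B × ∣ seq y′ n ∣ ℚ.< B
    step′ : ∀ B {η} → 0ℚ ℚ.< B → Bound B → (∃ λ δ → 0ℚ ℚ.< δ × B ℚ.* δ ≡ η) →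
            Close (seq (x * y)) (seq (x′ * y′)) (η ℚ.+ η)
    step′ B 0<B bd (δ , 0<δ , refl) = eventually-map
      (λ {n} ((px , py) , p , q) →
        dist-* B δ (seq x n) (seq y n) (seq x′ n) (seq y′ n) 0<B px py p q)
      (both bd (both (x≈x′ δ 0<δ) (y≈y′ δ 0<δ)))
    step : ∀ {ε} → (∃ λ η → 0ℚ ℚ.< η × η ℚ.+ η ≡ ε) → (∃ λ B → 0ℚ ℚ.< B × Bound B) →
           Close (seq (x * y)) (seq (x′ * y′)) ε
    step (η , 0<η , refl) (B , 0<B , bd) = step′ B 0<B bd (divide B 0<B η 0<η)

  isCommutativeRing : IsCommutativeRing _≈_ _+_ _*_ -_ 0ℝ 1ℝ
  isCommutativeRing = record
    { isRing = record
      { +-isAbelianGroup = record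
        { isGroup = record
          { isMonoid = record
            { isSemigroup = record
              { isMagma = record
                { isEquivalence = record
                  { refl  = λ {x} → pointwise x x λ _ → refl
                  ; sym   = λ {x} {y} → ≈-sym {x} {y}
                  ; trans = λ {x} {y} {z} → ≈-trans {x} {y} {z}
                  }
                ; ∙-cong = λ {x} {x′} {y} {y′} → +-cong {x} {x′} {y} {y′}
                }
              ; assoc = λ x y z → pointwise (x + y + z) (x + (y + z))
                  λ n → ℚ.+-assoc (seq x n) (seq y n) (seq z n)
              }
            ; identity =
                (λ x → pointwise (0ℝ + x) x λ n → ℚ.+-identityˡ (seq x n)) ,
                (λ x → pointwise (x + 0ℝ) x λ n → ℚ.+-identityʳ (seq x n))
            }
          ; inverse =
              (λ x → pointwise (- x + x) 0ℝ λ n → ℚ.+-inverseˡ (seq x n)) ,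
              (λ x → pointwise (x + - x) 0ℝ λ n → ℚ.+-inverseʳ (seq x n))
          ; ⁻¹-cong = λ {x} {y} → -‿cong {x} {y}
          }
        ; comm = λ x y → pointwise (x + y) (y + x) λ n → ℚ.+-comm (seq x n) (seq y n)
        }
      ; *-cong = λ {x} {x′} {y} {y′} → *-cong {x} {x′} {y} {y′}
      ; *-assoc = λ x y z → pointwise (x * y * z) (x * (y * z))
          λ n → ℚ.*-assoc (seq x n) (seq y n) (seq z n)
      ; *-identity =
          (λ x → pointwise (1ℝ * x) x λ n → ℚ.*-identityˡ (seq x n)) ,
          (λ x → pointwise (x * 1ℝ) x λ n → ℚ.*-identityʳ (seq x n))
      ; distrib =
          (λ x y z → pointwise (x * (y + z)) (x * y + x * z)
            λ n → ℚ.*-distribˡ-+ (seq x n) (seq y n) (seq z n)) ,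
          (λ x y z → pointwise ((y + z) * x) (y * x + z * x)
            λ n → ℚ.*-distribʳ-+ (seq x n) (seq y n) (seq z n))
      }
    ; *-comm = λ x y → pointwise (x * y) (y * x) λ n → ℚ.*-comm (seq x n) (seq y n)
    }

ℝ-commutativeRing : CommutativeRing 0ℓ 0ℓ
ℝ-commutativeRing = record { isCommutativeRing = isCommutativeRing }

private module R = CommutativeRing ℝ-commutativeRing

∑ : (Fin n → ℝ) → ℝ
∑ = Sum.sum R.+-commutativeMonoid

Near : ℚ → Rel ℝ 0ℓ
Near ε x y = x - y < fromℚ ε × y - x < fromℚ ε

private

  0≤0 : 0ℝ ≤ 0ℝ
  0≤0 (ε , 0<ε , N , p) =
    ℚ.<-irrefl refl (ℚ.<-≤-trans (ℚ.+-monoʳ-< 0ℚ 0<ε) (p N ℕ.≤-refl))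

  near-0 : ∀ ε → 0ℚ ℚ.< ε → Near ε 0ℝ 0ℝ
  near-0 ε 0<ε = 0<ε′ , 0<ε′
    where
    step : ∀ {ε} → (∃ λ δ → 0ℚ ℚ.< δ × δ ℚ.+ δ ≡ ε) → 0ℝ - 0ℝ < fromℚ ε
    step (δ , 0<δ , refl) = δ , 0<δ , always λ _ → ℚ.+-monoˡ-≤ δ (ℚ.<⇒≤ 0<δ)
    0<ε′ = step (halve ε 0<ε)

VectorSpace : (m ℓ : Level) → Set (lsuc (m ⊔ ℓ))
VectorSpace m ℓ = Module ℝ-commutativeRing m ℓ

module _ (V : VectorSpace m ℓ) where
  open Module V

  linearCombination : (Fin n → ℝ) → (Fin n → Carrierᴹ) → Carrierᴹ
  linearCombination r v = Sum.sum +ᴹ-commutativeMonoid λ i → r i *ₗ v i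

  record IsBasis (v : Fin n → Carrierᴹ) : Set (m ⊔ ℓ) where
    field
      independent : ∀ r → linearCombination r v ≈ᴹ 0ᴹ → ∀ i → r i ≈ 0ℝ
      spanning    : ∀ x → ∃ λ r → x ≈ᴹ linearCombination r v

-- Formal ℝ-linear combinations of elements of S, modulo the congruence
-- generated by the vector space axioms and [ σ ] ≋ [ τ ] for σ ∼ τ.

module Free {S : Set s} (_∼_ : Rel S ℓ) where

  infixl 6 _⊕_
  infixr 7 _·_
  infix  8 ⊖_
  infix  4 _≋_

  data Carrier : Set s where
    [_] : S → Carrier
    𝟘   : Carrier
    _⊕_ : Carrier → Carrier → Carrier
    ⊖_  : Carrier → Carrier
    _·_ : ℝ → Carrier → Carrier

  data _≋_ : Rel Carrier (s ⊔ ℓ) where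
    ≋-refl       : ∀ {x} → x ≋ x
    ≋-sym        : ∀ {x y} → x ≋ y → y ≋ x
    ≋-trans      : ∀ {x y z} → x ≋ y → y ≋ z → x ≋ z
    []-cong      : ∀ {σ τ} → σ ∼ τ → [ σ ] ≋ [ τ ]
    ⊕-cong       : ∀ {x x′ y y′} → x ≋ x′ → y ≋ y′ → x ⊕ y ≋ x′ ⊕ y′
    ⊖-cong       : ∀ {x y} → x ≋ y → ⊖ x ≋ ⊖ y
    ·-cong       : ∀ {r r′ x x′} → r ≈ r′ → x ≋ x′ → r · x ≋ r′ · x′
    ⊕-assoc      : ∀ x y z → (x ⊕ y) ⊕ z ≋ x ⊕ (y ⊕ z)
    ⊕-comm       : ∀ x y → x ⊕ y ≋ y ⊕ x
    ⊕-identityˡ  : ∀ x → 𝟘 ⊕ x ≋ x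
    ⊖-inverseˡ   : ∀ x → ⊖ x ⊕ x ≋ 𝟘
    ·-zeroˡ      : ∀ x → 0ℝ · x ≋ 𝟘
    ·-zeroʳ      : ∀ r → r · 𝟘 ≋ 𝟘
    ·-distribˡ   : ∀ r x y → r · (x ⊕ y) ≋ r · x ⊕ r · y
    ·-distribʳ   : ∀ x r r′ → (r + r′) · x ≋ r · x ⊕ r′ · x
    ·-assoc      : ∀ r r′ x → (r * r′) · x ≋ r · (r′ · x)
    ·-identityˡ  : ∀ x → 1ℝ · x ≋ x

  vectorSpace : VectorSpace s (s ⊔ ℓ)
  vectorSpace = record
    { _≈ᴹ_ = _≋_
    ; _+ᴹ_ = _⊕_
    ; _*ₗ_ = _·_
    ; 0ᴹ   = 𝟘
    ; -ᴹ_  = ⊖_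
    ; isModule = IsModuleFromLeft.isModule {commutativeRing = ℝ-commutativeRing} record
      { isLeftModule = record
        { isLeftSemimodule = record
          { +ᴹ-isCommutativeMonoid = record
            { isMonoid = record
              { isSemigroup = record
                { isMagma = record
                  { isEquivalence = record { refl = ≋-refl ; sym = ≋-sym ; trans = ≋-trans }
                  ; ∙-cong = ⊕-cong
                  }
                ; assoc = ⊕-assoc
                }
              ; identity = ⊕-identityˡ , λ x → ≋-trans (⊕-comm x 𝟘) (⊕-identityˡ x)
              }
            ; comm = ⊕-comm
            }
          ; isPreleftSemimodule = record
            { *ₗ-cong      = ·-cong
            ; *ₗ-zeroˡ     = ·-zeroˡ
            ; *ₗ-distribʳ  = ·-distribʳ
            ; *ₗ-identityˡ = ·-identityˡ
            ; *ₗ-assoc     = ·-assoc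
            ; *ₗ-zeroʳ     = ·-zeroʳ
            ; *ₗ-distribˡ  = ·-distribˡ
            }
          }
        ; -ᴹ‿cong = ⊖-cong
        ; -ᴹ‿inverse = ⊖-inverseˡ , λ x → ≋-trans (⊕-comm x (⊖ x)) (⊖-inverseˡ x)
        }
      }
    }

  linearExtension : (W : VectorSpace m ℓ′) → (S → Module.Carrierᴹ W) →
                    Carrier → Module.Carrierᴹ W
  linearExtension W f = go
    where
    open Module W
    go : Carrier → Carrierᴹ
    go [ σ ]   = f σ
    go 𝟘       = 0ᴹ
    go (x ⊕ y) = go x +ᴹ go y
    go (⊖ x)   = -ᴹ go x
    go (r · x) = r *ₗ go x

private
  module Differences (V : VectorSpace m ℓ) where
    open Module V
    open AbelianGroup +ᴹ-abelianGroup
    open SetoidReasoning ≈ᴹ-setoid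

    diff : Carrierᴹ → Carrierᴹ → Carrierᴹ
    diff x y = x +ᴹ (-ᴹ y)

    interchange : ∀ a b c d → (a +ᴹ b) +ᴹ (c +ᴹ d) ≈ᴹ (a +ᴹ c) +ᴹ (b +ᴹ d)
    interchange a b c d = begin
      (a +ᴹ b) +ᴹ (c +ᴹ d)  ≈⟨ +ᴹ-assoc a b (c +ᴹ d) ⟩
      a +ᴹ (b +ᴹ (c +ᴹ d))  ≈⟨ +ᴹ-congˡ (≈ᴹ-sym (+ᴹ-assoc b c d)) ⟩
      a +ᴹ ((b +ᴹ c) +ᴹ d)  ≈⟨ +ᴹ-congˡ (+ᴹ-congʳ (+ᴹ-comm b c)) ⟩
      a +ᴹ ((c +ᴹ b) +ᴹ d)  ≈⟨ +ᴹ-congˡ (+ᴹ-assoc c b d) ⟩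
      a +ᴹ (c +ᴹ (b +ᴹ d))  ≈⟨ +ᴹ-assoc a c (b +ᴹ d) ⟨
      (a +ᴹ c) +ᴹ (b +ᴹ d)  ∎

    diff-self : ∀ {x y} → x ≈ᴹ y → diff x y ≈ᴹ 0ᴹ
    diff-self = x≈y⇒x∙y⁻¹≈ε

    diff-swap : ∀ x y → diff y x ≈ᴹ -ᴹ diff x y
    diff-swap x y = ≈ᴹ-sym (⁻¹-anti-homo‿- x y)

    diff-trans : ∀ x y z → diff x z ≈ᴹ diff x y +ᴹ diff y z
    diff-trans x y z = begin
      diff x z                           ≈⟨ +ᴹ-congˡ (+ᴹ-identityˡ (-ᴹ z)) ⟨
      x +ᴹ (0ᴹ +ᴹ -ᴹ z)                  ≈⟨ +ᴹ-congˡ (+ᴹ-congʳ (-ᴹ‿inverseˡ y)) ⟨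
      x +ᴹ ((-ᴹ y +ᴹ y) +ᴹ -ᴹ z)         ≈⟨ +ᴹ-congˡ (+ᴹ-assoc (-ᴹ y) y (-ᴹ z)) ⟩
      x +ᴹ (-ᴹ y +ᴹ diff y z)            ≈⟨ +ᴹ-assoc x (-ᴹ y) (diff y z) ⟨
      diff x y +ᴹ diff y z               ∎

    diff-+ : ∀ x x′ y y′ → diff (x +ᴹ x′) (y +ᴹ y′) ≈ᴹ diff x y +ᴹ diff x′ y′
    diff-+ x x′ y y′ = begin
      diff (x +ᴹ x′) (y +ᴹ y′)           ≈⟨ +ᴹ-congˡ (⁻¹-∙-comm y y′) ⟨
      (x +ᴹ x′) +ᴹ (-ᴹ y +ᴹ -ᴹ y′)       ≈⟨ interchange x x′ (-ᴹ y) (-ᴹ y′) ⟩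
      diff x y +ᴹ diff x′ y′             ∎

    diff-neg : ∀ x y → diff (-ᴹ x) (-ᴹ y) ≈ᴹ -ᴹ diff x y
    diff-neg x y = ⁻¹-∙-comm x (-ᴹ y)

    *ₗ-neg : ∀ r x → r *ₗ (-ᴹ x) ≈ᴹ -ᴹ (r *ₗ x)
    *ₗ-neg r x = inverseˡ-unique (r *ₗ (-ᴹ x)) (r *ₗ x) (begin
      r *ₗ (-ᴹ x) +ᴹ r *ₗ x  ≈⟨ *ₗ-distribˡ r (-ᴹ x) x ⟨
      r *ₗ (-ᴹ x +ᴹ x)       ≈⟨ *ₗ-cong (R.refl {r}) (-ᴹ‿inverseˡ x) ⟩
      r *ₗ 0ᴹ                ≈⟨ *ₗ-zeroʳ r ⟩
      0ᴹ                     ∎)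

    diff-* : ∀ {r r′} x y → r ≈ r′ → diff (r *ₗ x) (r′ *ₗ y) ≈ᴹ r *ₗ diff x y
    diff-* {r} {r′} x y r≈r′ = begin
      diff (r *ₗ x) (r′ *ₗ y)    ≈⟨ +ᴹ-congˡ (-ᴹ‿cong (*ₗ-cong r≈r′ ≈ᴹ-refl)) ⟨
      diff (r *ₗ x) (r *ₗ y)     ≈⟨ +ᴹ-congˡ (*ₗ-neg r y) ⟨
      r *ₗ x +ᴹ r *ₗ (-ᴹ y)      ≈⟨ *ₗ-distribˡ r x (-ᴹ y) ⟨
      r *ₗ diff x y              ∎

-- A topological space, presented by its points (up to _≈ₚ_) and its open sets.
-- The topology axioms are not recorded: homology only uses which sets are open.

record Space : Set₁ where
  field
    points : Setoid 0ℓ 0ℓ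
  open Setoid points public using () renaming (Carrier to Point; _≈_ to _≈ₚ_)
  field
    IsOpen : (Point → Set) → Set

-- The standard simplex, with barycentric coordinates.

record Δ (n : ℕ) : Set where
  field
    coord    : Fin (suc n) → ℝ
    nonneg   : ∀ i → 0ℝ ≤ coord i
    sum-to-1 : ∑ coord ≈ 1ℝ

open Δ

_≈Δ_ : Rel (Δ n) 0ℓ
s ≈Δ t = ∀ i → coord s i ≈ coord t i

IsOpenΔ : (Δ n → Set) → Set
IsOpenΔ U = ∀ t → U t → ∃ λ ε → 0ℚ ℚ.< ε ×
  (∀ s → (∀ i → Near ε (coord s i) (coord t i)) → U s)

private

  insertAt₂ : (P : Rel ℝ 0ℓ) → P 0ℝ 0ℝ → (s t : Fin n → ℝ) → (∀ j → P (s j) (t j)) →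
              ∀ i j → P (insertAt s i 0ℝ j) (insertAt t i 0ℝ j)
  insertAt₂             P p₀ s t p zero    zero    = p₀
  insertAt₂             P p₀ s t p zero    (suc j) = p j
  insertAt₂ {n = suc _} P p₀ s t p (suc i) zero    = p zero
  insertAt₂ {n = suc _} P p₀ s t p (suc i) (suc j) =
    insertAt₂ P p₀ (s ∘ suc) (t ∘ suc) (p ∘ suc) i j

  ∑-insertAt : (t : Fin n → ℝ) (i : Fin (suc n)) → ∑ (insertAt t i 0ℝ) ≈ ∑ t
  ∑-insertAt             t zero    = R.+-identityˡ (∑ t)
  ∑-insertAt {n = suc _} t (suc i) =
    R.+-cong {t zero} {t zero} {∑ (insertAt (t ∘ suc) i 0ℝ)} {∑ (t ∘ suc)}
      (R.refl {t zero}) (∑-insertAt (t ∘ suc) i)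

-- The inclusion of the face opposite to the i-th vertex.

δ : Fin (suc (suc n)) → Δ n → Δ (suc n)
δ i t = record
  { coord    = insertAt (coord t) i 0ℝ
  ; nonneg   = insertAt₂ (λ _ r → 0ℝ ≤ r) 0≤0 (coord t) (coord t) (nonneg t) i
  ; sum-to-1 = R.trans {∑ (insertAt (coord t) i 0ℝ)} {∑ (coord t)} {1ℝ}
                 (∑-insertAt (coord t) i) (sum-to-1 t)
  }

module Singular (X : Space) where
  open Space X

  record Simplex (n : ℕ) : Set₁ where
    field
      map        : Δ n → Point
      cong       : ∀ {s t} → s ≈Δ t → map s ≈ₚ map t
      continuous : ∀ U → IsOpen U → IsOpenΔ (U ∘ map)

  open Simplex

  _∼_ : Rel (Simplex n) 0ℓ
  σ ∼ τ = ∀ t → map σ t ≈ₚ map τ t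

  face : Fin (suc (suc n)) → Simplex (suc n) → Simplex n
  face i σ = record
    { map        = map σ ∘ δ i
    ; cong       = λ {s} {t} s≈t →
        cong σ (insertAt₂ _≈_ (R.refl {0ℝ}) (coord s) (coord t) s≈t i)
    ; continuous = λ U open-U t Ut →
        let ε , 0<ε , ball⊆U = continuous σ U open-U (δ i t) Ut
        in  ε , 0<ε , λ s near → ball⊆U (δ i s)
              (insertAt₂ (Near ε) (near-0 ε 0<ε) (coord s) (coord t) near i)
    }

  Chains : ℕ → VectorSpace (lsuc 0ℓ) (lsuc 0ℓ)
  Chains n = Free.vectorSpace (_∼_ {n})

  Chain : ℕ → Set₁
  Chain n = Module.Carrierᴹ (Chains n)

  sign : Fin n → ℝ
  sign i = (- 1ℝ) ^ toℕ i
    where open Exponent R.semiring using (_^_)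

  ∂ : Chain (suc n) → Chain n
  ∂ {n} = Free.linearExtension _∼_ (Chains n) λ σ →
    linearCombination (Chains n) sign λ i → Free.[ face i σ ]

  private
    module C₀ = Module (Chains 0)
    module C₁ = Module (Chains 1)
    open Differences (Chains 1)

  record Cycle : Set₁ where
    field
      chain    : Chain 1
      boundary : ∂ chain C₀.≈ᴹ C₀.0ᴹ

  open Cycle

  -- The boundaries in degree 1 are the chains ∂ e, so H₁ is Cycle modulo Homologous.

  Homologous : Rel Cycle (lsuc 0ℓ)
  Homologous x y = ∃ λ (e : Chain 2) → chain x C₁.+ᴹ (C₁.-ᴹ chain y) C₁.≈ᴹ ∂ e

  private
    _⊞_ : Cycle → Cycle → Cycle
    x ⊞ y = record
      { chain    = chain x C₁.+ᴹ chain y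
      ; boundary = C₀.≈ᴹ-trans (C₀.+ᴹ-cong (boundary x) (boundary y)) (C₀.+ᴹ-identityˡ C₀.0ᴹ)
      }

    zeroCycle : Cycle
    zeroCycle = record { chain = C₁.0ᴹ ; boundary = C₀.≈ᴹ-refl }

    ⊟_ : Cycle → Cycle
    ⊟ x = record
      { chain    = C₁.-ᴹ chain x
      ; boundary = C₀.≈ᴹ-trans (C₀.-ᴹ‿cong (boundary x))
                     (AbelianGroup.ε⁻¹≈ε C₀.+ᴹ-abelianGroup)
      }

    _⊡_ : ℝ → Cycle → Cycle
    r ⊡ x = record
      { chain    = r C₁.*ₗ chain x
      ; boundary = C₀.≈ᴹ-trans (C₀.*ₗ-cong (R.refl {r}) (boundary x)) (C₀.*ₗ-zeroʳ r)
      }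

    fromChains : ∀ {x y} → chain x C₁.≈ᴹ chain y → Homologous x y
    fromChains x≈y = Free.𝟘 , diff-self x≈y

    homologous-isEquivalence : IsEquivalence Homologous
    homologous-isEquivalence = record
      { refl  = λ {x} → fromChains {x} {x} C₁.≈ᴹ-refl
      ; sym   = λ {x} {y} (e , eq) → Free.⊖ e ,
          C₁.≈ᴹ-trans (diff-swap (chain x) (chain y)) (C₁.-ᴹ‿cong eq)
      ; trans = λ {x} {y} {z} (e , eq) (e′ , eq′) → e Free.⊕ e′ ,
          C₁.≈ᴹ-trans (diff-trans (chain x) (chain y) (chain z)) (C₁.+ᴹ-cong eq eq′)
      }

  H₁ : VectorSpace (lsuc 0ℓ) (lsuc 0ℓ)
  H₁ = record
    { _≈ᴹ_ = Homologous
    ; _+ᴹ_ = _⊞_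
    ; _*ₗ_ = _⊡_
    ; 0ᴹ   = zeroCycle
    ; -ᴹ_  = ⊟_
    ; isModule = IsModuleFromLeft.isModule {commutativeRing = ℝ-commutativeRing} record
      { isLeftModule = record
        { isLeftSemimodule = record
          { +ᴹ-isCommutativeMonoid = record
            { isMonoid = record
              { isSemigroup = record
                { isMagma = record
                  { isEquivalence = homologous-isEquivalence
                  ; ∙-cong = λ {x} {y} {x′} {y′} (e , eq) (e′ , eq′) → e Free.⊕ e′ ,
                      C₁.≈ᴹ-trans (diff-+ (chain x) (chain x′) (chain y) (chain y′))
                        (C₁.+ᴹ-cong eq eq′)
                  }
                ; assoc = λ x y z → fromChains {(x ⊞ y) ⊞ z} {x ⊞ (y ⊞ z)}
                    (C₁.+ᴹ-assoc (chain x) (chain y) (chain z))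
                }
              ; identity =
                  (λ x → fromChains {zeroCycle ⊞ x} {x} (C₁.+ᴹ-identityˡ (chain x))) ,
                  (λ x → fromChains {x ⊞ zeroCycle} {x} (C₁.+ᴹ-identityʳ (chain x)))
              }
            ; comm = λ x y → fromChains {x ⊞ y} {y ⊞ x} (C₁.+ᴹ-comm (chain x) (chain y))
            }
          ; isPreleftSemimodule = record
            { *ₗ-cong = λ {r} {r′} {x} {y} r≈r′ (e , eq) → r Free.· e ,
                C₁.≈ᴹ-trans (diff-* (chain x) (chain y) r≈r′) (C₁.*ₗ-cong (R.refl {r}) eq)
            ; *ₗ-zeroˡ = λ x → fromChains {0ℝ ⊡ x} {zeroCycle} (C₁.*ₗ-zeroˡ (chain x))
            ; *ₗ-distribʳ = λ x r r′ → fromChains {(r + r′) ⊡ x} {(r ⊡ x) ⊞ (r′ ⊡ x)}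
                (C₁.*ₗ-distribʳ (chain x) r r′)
            ; *ₗ-identityˡ = λ x → fromChains {1ℝ ⊡ x} {x} (C₁.*ₗ-identityˡ (chain x))
            ; *ₗ-assoc = λ r r′ x → fromChains {(r * r′) ⊡ x} {r ⊡ (r′ ⊡ x)}
                (C₁.*ₗ-assoc r r′ (chain x))
            ; *ₗ-zeroʳ = λ r → fromChains {r ⊡ zeroCycle} {zeroCycle} (C₁.*ₗ-zeroʳ r)
            ; *ₗ-distribˡ = λ r x y → fromChains {r ⊡ (x ⊞ y)} {(r ⊡ x) ⊞ (r ⊡ y)}
                (C₁.*ₗ-distribˡ r (chain x) (chain y))
            }
          }
        ; -ᴹ‿cong = λ {x} {y} (e , eq) → Free.⊖ e ,
            C₁.≈ᴹ-trans (diff-neg (chain x) (chain y)) (C₁.-ᴹ‿cong eq)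
        ; -ᴹ‿inverse =
            (λ x → fromChains {(⊟ x) ⊞ x} {zeroCycle} (C₁.-ᴹ‿inverseˡ (chain x))) ,
            (λ x → fromChains {x ⊞ (⊟ x)} {zeroCycle} (C₁.-ᴹ‿inverseʳ (chain x)))
        }
      }
    }

open Singular public using (H₁)

record ℂ : Set where
  constructor _+i_
  field
    re im : ℝ

open ℂ

infix  4 _≈ᶜ_
infixl 6 _+ᶜ_
infixl 7 _*ᶜ_

_≈ᶜ_ : Rel ℂ 0ℓ
z ≈ᶜ w = re z ≈ re w × im z ≈ im w

_+ᶜ_ _*ᶜ_ : ℂ → ℂ → ℂ
z +ᶜ w = (re z + re w) +i (im z + im w)
z *ᶜ w = (re z * re w - im z * im w) +i (re z * im w + im z * re w)

fromℤᶜ : ℤ → ℂ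
fromℤᶜ k = fromℤ k +i 0ℝ

normSq : ℂ → ℝ
normSq z = re z * re z + im z * im z

record ℍ : Set where
  field
    val  : ℂ
    im>0 : 0ℝ < im val

open ℍ

IsOpenℍ : (ℍ → Set) → Set
IsOpenℍ U = ∀ z → U z → ∃ λ ε → 0ℚ ℚ.< ε × (∀ w →
  Near ε (re (val w)) (re (val z)) → Near ε (im (val w)) (im (val z)) → U w)

-- The preimage of Γ₀(p) ≤ PSL₂(ℤ) in SL₂(ℤ); it has the same orbits on ℍ,
-- and it contains - 1.

record Γ₀ (p : ℕ) : Set where
  field
    a b c d : ℤ
    det     : a ℤ.* d ℤ.- b ℤ.* c ≡ + 1
    p∣c     : + p ∣ c

-- w = (a z + b) / (c z + d), with the nonzero denominator cleared.

_⟨_⟩↦_ : ∀ {p} → ℍ → Γ₀ p → ℍ → Set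
z ⟨ γ ⟩↦ w = val w *ᶜ (fromℤᶜ c *ᶜ val z +ᶜ fromℤᶜ d) ≈ᶜ fromℤᶜ a *ᶜ val z +ᶜ fromℤᶜ b
  where open Γ₀ γ

Γ₀\ℍ : ℕ → Setoid 0ℓ 0ℓ
Γ₀\ℍ p = EqClosure.setoid λ z w → Σ (Γ₀ p) λ γ → z ⟨ γ ⟩↦ w

Y₀ : ℕ → Space
Y₀ p = record
  { points = Γ₀\ℍ p
  ; IsOpen = λ U → U Respects (Setoid._≈_ (Γ₀\ℍ p)) × IsOpenℍ U
  }

-- The point num / den of ℙ¹(ℚ). The pairs (num , den) and (- num , - den) are
-- the same point; the orbit relation identifies them, as - 1 is in Γ₀ p.

record ℙ¹ℚ : Set where
  field
    num den : ℤ
    coprime : Coprime num den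

open ℙ¹ℚ

Γ₀\ℙ¹ℚ : ℕ → Setoid 0ℓ 0ℓ
Γ₀\ℙ¹ℚ p = EqClosure.setoid λ s t → Σ (Γ₀ p) λ γ → let open Γ₀ γ in
  num t ≡ a ℤ.* num s ℤ.+ b ℤ.* den s × den t ≡ c ℤ.* num s ℤ.+ d ℤ.* den s

-- The horoball Im (σ⁻¹ z) > M, for any σ ∈ SL₂(ℤ) with σ ∞ = num s / den s:
-- Im (σ⁻¹ z) = Im z / |den s · z - num s|².

Horoball : ℙ¹ℚ → ℚ → ℍ → Set
Horoball s M z =
  fromℚ M * normSq (fromℤᶜ (den s) *ᶜ val z +ᶜ fromℤᶜ (ℤ.- num s)) < im (val z)

-- The compactification Γ₀(p) \ (ℍ ∪ ℙ¹(ℚ)) of Y₀ p.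

X₀ : ℕ → Space
X₀ p = record
  { points = points
  ; IsOpen = λ U → U Respects (Setoid._≈_ points) × IsOpenℍ (U ∘ inj₁) ×
      (∀ s → U (inj₂ s) → ∃ λ M → ∀ z → Horoball s M z → U (inj₁ z))
  }
  where points = Γ₀\ℍ p ⊎ₛ Γ₀\ℙ¹ℚ p

V : ℕ → VectorSpace (lsuc 0ℓ) (lsuc 0ℓ)
V p = H₁ (Y₀ p)

-- The genus of the punctured surface Y₀ p is that of the closed orientable
-- surface X₀ p, that is, half its first Betti number.

IsGenus : ℕ → ℕ → Set₁
IsGenus p g = ∃ λ (v : Fin (2 ℕ.* g) → Module.Carrierᴹ (H₁ (X₀ p))) → IsBasis (H₁ (X₀ p)) v

module _ {p : ℕ} {J I K : ℕ} where
  open Module (V p)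

  IsSolution : (Fin J → Carrierᴹ) → (Fin I → Fin K → ℝ) → (Fin J → Fin K → ℝ) →
               (Fin I → Carrierᴹ) → Set₁
  IsSolution v a b x = ∀ k →
    linearCombination (V p) (λ i → a i k) x +ᴹ
    linearCombination (V p) (λ j → b j k) v ≈ᴹ 0ᴹ

subsetSum : Subset n → (Fin n → ℝ) → ℝ
subsetSum A f = ∑ λ k → if lookup A k then f k else 0ℝ

InMinusOneZeroOne : ℝ → Set
InMinusOneZeroOne r = r ≈ - 1ℝ ⊎ r ≈ 0ℝ ⊎ r ≈ 1ℝ

{-# OPTIONS --safe #-}

-- If all subset sums of e are -1, 0 or 1 and e has a nonzero entry in row κ,
-- then eliminating row κ with pivot e keeps the subset sums of every other such
-- column in {-1,0,1}: the sum over A becomes the sum over A or the sum over A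
-- with κ toggled. Eliminating all variables but one thus leaves an equation
-- ± t = β with β in {-1,0,1}. The system in V_p is, coordinate by coordinate,
-- such a scalar system, and it inherits the uniqueness of the solution.

module Submission where

open import Algebra.Bundles using (CommutativeRing)
import Algebra.Module.Properties.Semimodule as SemimoduleProperties
open import Algebra.Module.Bundles using (Module)
import Algebra.Properties.AbelianGroup as AbelianGroupProperties
import Algebra.Properties.CommutativeMonoid.Sum as CommutativeMonoidSum
import Algebra.Properties.Ring as RingProperties
import Algebra.Properties.Semiring.Sum as SemiringSum
import Algebra.Solver.Ring.NaturalCoefficients.Default as SemiringSolver
open import Data.Bool.Base using (true; false; not; if_then_else_)
open import Data.Empty using (⊥-elim)
open import Data.Fin.Base using (Fin; zero; suc; punchIn)
open import Data.Fin.Subset using (Subset; ⊥)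
open import Data.Nat.Base as ℕ using (ℕ; suc)
import Data.Nat.Properties as ℕ
open import Data.Nat.Primality using (Prime)
open import Data.Product using (∃; ∃!; _×_; _,_; proj₁; proj₂)
open import Data.Rational.Base as ℚ using (0ℚ; 1ℚ)
import Data.Rational.Properties as ℚ
open import Data.Sum.Base using (_⊎_; inj₁; inj₂; [_,_]′)
open import Data.Vec.Base using (_∷_; lookup; updateAt)
open import Data.Vec.Functional using (insertAt; removeAt)
open import Data.Vec.Functional.Properties using (insertAt-lookup; insertAt-punchIn)
open import Function.Base using (_∘_)
import Relation.Binary.Reasoning.Setoid as SetoidReasoning
open import Relation.Binary.PropositionalEquality as ≡ using (_≡_)
open import Relation.Nullary.Decidable using (False; toWitnessFalse)
open import Relation.Nullary.Negation using (¬_)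

TwoAndThreeNonzero : ∀ {r ℓ} → CommutativeRing r ℓ → Set ℓ
TwoAndThreeNonzero R = ¬ 1# + 1# ≈ 0# × ¬ 1# + 1# + 1# ≈ 0#
  where open CommutativeRing R

module SubsetSums {r ℓ} (R : CommutativeRing r ℓ) (2,3≉0 : TwoAndThreeNonzero R) where

  open CommutativeRing R hiding (zero)
  open RingProperties ring
  open SemiringSum semiring
  open SemiringSolver commutativeSemiring
  open SetoidReasoning setoid

  Sign Ternary : Carrier → Set ℓ
  Sign x    = x ≈ 1# ⊎ x ≈ - 1#
  Ternary x = x ≈ - 1# ⊎ x ≈ 0# ⊎ x ≈ 1#

  ternary-resp : ∀ {x y} → x ≈ y → Ternary x → Ternary y
  ternary-resp x≈y (inj₁ p)        = inj₁ (trans (sym x≈y) p)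
  ternary-resp x≈y (inj₂ (inj₁ p)) = inj₂ (inj₁ (trans (sym x≈y) p))
  ternary-resp x≈y (inj₂ (inj₂ p)) = inj₂ (inj₂ (trans (sym x≈y) p))

  ternary-neg : ∀ {x} → Ternary x → Ternary (- x)
  ternary-neg (inj₁ p)        = inj₂ (inj₂ (trans (-‿cong p) (-‿involutive 1#)))
  ternary-neg (inj₂ (inj₁ p)) = inj₂ (inj₁ (trans (-‿cong p) -0#≈0#))
  ternary-neg (inj₂ (inj₂ p)) = inj₁ (-‿cong p)

  x*-1≈-x : ∀ x → x * - 1# ≈ - x
  x*-1≈-x x = trans (sym (-‿distribʳ-* x 1#)) (-‿cong (*-identityʳ x))

  ternary-*-sign : ∀ {x s} → Sign s → Ternary x → Ternary (x * s)
  ternary-*-sign {x} {s} (inj₁ p) t =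
    ternary-resp (sym (trans (*-congˡ p) (*-identityʳ x))) t
  ternary-*-sign {x} {s} (inj₂ p) t =
    ternary-resp (sym (trans (*-congˡ p) (x*-1≈-x x))) (ternary-neg t)

  sign-neg : ∀ {s} → Sign s → Sign (- s)
  sign-neg (inj₁ p) = inj₂ (-‿cong p)
  sign-neg (inj₂ p) = inj₁ (trans (-‿cong p) (-‿involutive 1#))

  sign-* : ∀ {s t} → Sign s → Sign t → Sign (s * t)
  sign-* {s} p (inj₁ q) with p
  ... | inj₁ p′ = inj₁ (trans (*-cong p′ q) (*-identityʳ 1#))
  ... | inj₂ p′ = inj₂ (trans (*-cong p′ q) (*-identityʳ (- 1#)))
  sign-* {s} p (inj₂ q) =
    [ (λ e → inj₁ (trans eq e)) , (λ e → inj₂ (trans eq e)) ]′ (sign-neg p)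
    where eq = trans (*-congˡ q) (x*-1≈-x s)

  sign-square : ∀ {s} → Sign s → s * s ≈ 1#
  sign-square (inj₁ p) = trans (*-cong p p) (*-identityʳ 1#)
  sign-square (inj₂ p) = trans (*-cong p p) (trans (x*-1≈-x (- 1#)) (-‿involutive 1#))

  1≉0 : ¬ 1# ≈ 0#
  1≉0 p = proj₁ 2,3≉0 (trans (+-cong p p) (+-identityˡ 0#))

  2-not-ternary : ¬ Ternary (1# + 1#)
  2-not-ternary (inj₁ p)        = proj₂ 2,3≉0 (trans (+-congʳ p) (-‿inverseˡ 1#))
  2-not-ternary (inj₂ (inj₁ p)) = proj₁ 2,3≉0 p
  2-not-ternary (inj₂ (inj₂ p)) = 1≉0 (+-identityʳ-unique 1# 1# p)

  sign+sign-not-ternary : ∀ {s} → Sign s → ¬ Ternary (s + s)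
  sign+sign-not-ternary {s} sgn t = 2-not-ternary (ternary-resp eq (ternary-*-sign sgn t))
    where
    eq : (s + s) * s ≈ 1# + 1#
    eq = trans (distribʳ s s s) (+-cong (sign-square sgn) (sign-square sgn))

  ternary-step : ∀ {x s} → Sign s → Ternary x → Ternary (x + s) → x ≈ 0# ⊎ x ≈ - s
  ternary-step         sgn      (inj₂ (inj₁ p)) _ = inj₁ p
  ternary-step         (inj₁ q) (inj₁ p)        _ = inj₂ (trans p (-‿cong (sym q)))
  ternary-step {x} {s} (inj₂ q) (inj₁ p)        t = ⊥-elim
    (sign+sign-not-ternary (inj₂ q) (ternary-resp (+-congʳ (trans p (sym q))) t))
  ternary-step {x} {s} (inj₁ q) (inj₂ (inj₂ p)) t = ⊥-elim
    (sign+sign-not-ternary (inj₁ q) (ternary-resp (+-congʳ (trans p (sym q))) t))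
  ternary-step         (inj₂ q) (inj₂ (inj₂ p)) _ =
    inj₂ (trans p (trans (sym (-‿involutive 1#)) (-‿cong (sym q))))

  Column : ℕ → Set r
  Column K = Fin K → Carrier

  subsetSum : ∀ {K} → Subset K → Column K → Carrier
  subsetSum A f = sum λ k → if lookup A k then f k else 0#

  AllSubsetSumsTernary : ∀ {K} → Column K → Set ℓ
  AllSubsetSumsTernary {K} f = ∀ (A : Subset K) → Ternary (subsetSum A f)

  toggle : ∀ {K} → Subset K → Fin K → Subset K
  toggle A k = updateAt A k not

  toggleSign : ∀ {K} → Subset K → Fin K → Carrier
  toggleSign A k = if lookup A k then - 1# else 1#

  toggleSign-sign : ∀ {K} (A : Subset K) k → Sign (toggleSign A k)
  toggleSign-sign A k with lookup A k
  ... | true  = inj₂ refl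
  ... | false = inj₁ refl

  subsetSum-toggle : ∀ {K} (A : Subset K) k f →
    subsetSum (toggle A k) f ≈ subsetSum A f + toggleSign A k * f k
  subsetSum-toggle (true ∷ A) zero f = begin
    0# + s                  ≈⟨ +-congʳ (-‿inverseʳ (f zero)) ⟨
    (f zero - f zero) + s   ≈⟨ solve 3 (λ x y z → (x :+ y) :+ z := (x :+ z) :+ y) refl
                                 (f zero) (- f zero) s ⟩
    (f zero + s) - f zero   ≈⟨ +-congˡ (-1*x≈-x (f zero)) ⟨
    (f zero + s) + - 1# * f zero ∎
    where s = subsetSum A (f ∘ suc)
  subsetSum-toggle (false ∷ A) zero f =
    solve 2 (λ x s → x :+ s := (con 0 :+ s) :+ con 1 :* x) refl
      (f zero) (subsetSum A (f ∘ suc))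
  subsetSum-toggle (x ∷ A) (suc k) f =
    trans (+-congˡ (subsetSum-toggle A k (f ∘ suc))) (sym (+-assoc _ _ _))

  subsetSum-linear : ∀ {K} (A : Subset K) f c e →
    subsetSum A (λ k → f k + c * e k) ≈ subsetSum A f + c * subsetSum A e
  subsetSum-linear A f c e = begin
    subsetSum A (λ k → f k + c * e k)                ≈⟨ sum-cong-≋ split ⟩
    sum (λ k → restrict f k + c * restrict e k)      ≈⟨ ∑-distrib-+ (restrict f) _ ⟩
    subsetSum A f + sum (λ k → c * restrict e k)     ≈⟨ +-congˡ (*-distribˡ-sum c (restrict e)) ⟨
    subsetSum A f + c * subsetSum A e                ∎
    where
    restrict : Column _ → Column _
    restrict f k = if lookup A k then f k else 0#
    split : ∀ k → restrict (λ k → f k + c * e k) k ≈ restrict f k + c * restrict e k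
    split k with lookup A k
    ... | true  = refl
    ... | false = solve 1 (λ c → con 0 := con 0 :+ c :* con 0) refl c

  entry-ternary : ∀ {K} (f : Column K) → AllSubsetSumsTernary f → ∀ k → Ternary (f k)
  entry-ternary {K} f ternary k = ternary-resp eq (ternary (toggle ⊥ k))
    where
    empty : ∀ {K} (f : Column K) → subsetSum ⊥ f ≈ 0#
    empty {ℕ.zero} f = refl
    empty {suc K}  f = trans (+-identityˡ _) (empty (f ∘ suc))
    outside : ∀ {K} (k : Fin K) → toggleSign ⊥ k ≈ 1#
    outside zero    = refl
    outside (suc k) = outside k
    eq : subsetSum (toggle ⊥ k) f ≈ f k
    eq = begin
      subsetSum (toggle ⊥ k) f                 ≈⟨ subsetSum-toggle ⊥ k f ⟩
      subsetSum ⊥ f + toggleSign ⊥ k * f k     ≈⟨ +-cong (empty f) (*-congʳ (outside k)) ⟩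
      0# + 1# * f k                            ≈⟨ solve 1 (λ x → con 0 :+ con 1 :* x := x) refl (f k) ⟩
      f k                                      ∎

  zero-or-pivot : ∀ {K} (f : Column K) → (∀ k → Ternary (f k)) →
                  (∀ k → f k ≈ 0#) ⊎ ∃ λ k → Sign (f k)
  zero-or-pivot {ℕ.zero} f t = inj₁ λ ()
  zero-or-pivot {suc K}  f t with t zero | zero-or-pivot (f ∘ suc) (t ∘ suc)
  ... | inj₁ p        | _            = inj₂ (zero , inj₂ p)
  ... | inj₂ (inj₂ p) | _            = inj₂ (zero , inj₁ p)
  ... | inj₂ (inj₁ p) | inj₂ (k , q) = inj₂ (suc k , q)
  ... | inj₂ (inj₁ p) | inj₁ q       = inj₁ λ { zero → p ; (suc k) → q k }

  combine : ∀ {n K} → (Fin n → Carrier) → (Fin n → Column K) → Column K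
  combine y a k = sum λ i → y i * a i k

  -- For a sign e κ and m = - e κ this is f - (f κ / e κ) e.

  eliminate : ∀ {K} → Column K → Fin K → Carrier → Column K → Column K
  eliminate e κ m f k = f k + m * f κ * e k

  module _ {K} (e : Column K) (κ : Fin K) (sgn : Sign (e κ)) where

    private
      m = - e κ

    m*eκ≈-1 : m * e κ ≈ - 1#
    m*eκ≈-1 = trans (sym (-‿distribˡ-* (e κ) (e κ))) (-‿cong (sign-square sgn))

    eliminate-ternary : AllSubsetSumsTernary e → ∀ f → AllSubsetSumsTernary f →
                        AllSubsetSumsTernary (eliminate e κ m f)
    eliminate-ternary te f tf A =
      [ (λ σ≈0 → ternary-resp (unchanged σ≈0) (tf A))
      , (λ σ≈-τs → ternary-resp (toggled σ≈-τs) (tf (toggle A κ)))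
      ]′ (ternary-step (sign-* (toggleSign-sign A κ) sgn) (te A)
           (ternary-resp (subsetSum-toggle A κ e) (te (toggle A κ))))
      where
      σ = subsetSum A e
      τ = toggleSign A κ
      unchanged : σ ≈ 0# → subsetSum A f ≈ subsetSum A (eliminate e κ m f)
      unchanged σ≈0 = sym (begin
        subsetSum A (eliminate e κ m f)   ≈⟨ subsetSum-linear A f (m * f κ) e ⟩
        subsetSum A f + m * f κ * σ       ≈⟨ +-congˡ (*-congˡ σ≈0) ⟩
        subsetSum A f + m * f κ * 0#      ≈⟨ solve 2 (λ x y → x :+ y :* con 0 := x) refl _ _ ⟩
        subsetSum A f                     ∎)
      toggled : σ ≈ - (τ * e κ) → subsetSum (toggle A κ) f ≈ subsetSum A (eliminate e κ m f)
      toggled σ≈-τs = sym (begin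
        subsetSum A (eliminate e κ m f)     ≈⟨ subsetSum-linear A f (m * f κ) e ⟩
        subsetSum A f + m * f κ * σ         ≈⟨ +-congˡ (*-congˡ (trans σ≈-τs (-‿distribʳ-* τ (e κ)))) ⟩
        subsetSum A f + m * f κ * (τ * m)   ≈⟨ solve 4 (λ x m y t → x :+ m :* y :* (t :* m) :=
                                                          x :+ (m :* m) :* (t :* y)) refl _ m (f κ) τ ⟩
        subsetSum A f + (m * m) * (τ * f κ) ≈⟨ +-congˡ (*-congʳ (sign-square (sign-neg sgn))) ⟩
        subsetSum A f + 1# * (τ * f κ)      ≈⟨ +-congˡ (*-identityˡ _) ⟩
        subsetSum A f + τ * f κ             ≈⟨ subsetSum-toggle A κ f ⟨
        subsetSum (toggle A κ) f            ∎)

  eliminate-combine : ∀ {K} (e : Column K) κ m {n} (y : Fin n → Carrier) (a : Fin n → Column K) k →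
    combine y (eliminate e κ m ∘ a) k ≈ eliminate e κ m (combine y a) k
  eliminate-combine e κ m {ℕ.zero} y a k =
    solve 2 (λ m x → con 0 := con 0 :+ m :* con 0 :* x) refl m (e k)
  eliminate-combine e κ m {suc n}  y a k = trans
    (+-congˡ (eliminate-combine e κ m (y ∘ suc) (a ∘ suc) k))
    (solve 7 (λ y p q m x u w →
        y :* (p :+ m :* q :* x) :+ (u :+ m :* w :* x) :=
        (y :* p :+ u) :+ m :* (y :* q :+ w) :* x) refl
      (y zero) (a zero k) (a zero κ) m (e k)
      (combine (y ∘ suc) (a ∘ suc) k) (combine (y ∘ suc) (a ∘ suc) κ))

  InSpan : ∀ {n K} → (Fin n → Column K) → Column K → Set _
  InSpan a d = ∃ λ y → ∀ k → d k ≈ combine y a k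

  inSpan-or-ternary : ∀ {K} n (a : Fin n → Column K) (d : Column K) →
    (∀ i → AllSubsetSumsTernary (a i)) → AllSubsetSumsTernary d →
    InSpan a d ⊎
    (∀ t b → AllSubsetSumsTernary b → InSpan a (λ k → t * d k + b k) → Ternary t)
  inSpan-or-ternary ℕ.zero a d ta td with zero-or-pivot d (entry-ternary d td)
  ... | inj₁ d≈0       = inj₁ ((λ ()) , d≈0)
  ... | inj₂ (k , sgn) = inj₂ λ t b tb (_ , eq) →
    ternary-resp (sym (solved t b eq)) (ternary-*-sign sgn (ternary-neg (entry-ternary b tb k)))
    where
    solved : ∀ t b → (∀ k → t * d k + b k ≈ 0#) → t ≈ - b k * d k
    solved t b eq = begin
      t                  ≈⟨ *-identityʳ t ⟨
      t * 1#             ≈⟨ *-congˡ (sign-square sgn) ⟨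
      t * (d k * d k)    ≈⟨ *-assoc t (d k) (d k) ⟨
      (t * d k) * d k    ≈⟨ *-congʳ (+-inverseˡ-unique (t * d k) (b k) (eq k)) ⟩
      - b k * d k        ∎
  inSpan-or-ternary (suc n) a d ta td
    with zero-or-pivot (a zero) (entry-ternary (a zero) (ta zero))
  ... | inj₁ a₀≈0 with inSpan-or-ternary n (a ∘ suc) d (ta ∘ suc) td
  ...   | inj₁ (y , eq) = inj₁ ((λ { zero → 0# ; (suc i) → y i }) , λ k →
            trans (eq k) (solve 2 (λ x u → u := con 0 :* x :+ u) refl (a zero k) _))
  ...   | inj₂ f = inj₂ λ t b tb (y , eq) → f t b tb (y ∘ suc , λ k →
            trans (eq k) (trans (+-congʳ (*-congˡ (a₀≈0 k)))
              (solve 2 (λ x u → x :* con 0 :+ u := u) refl (y zero) _)))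
  inSpan-or-ternary {K} (suc n) a d ta td | inj₂ (κ , sgn)
    with inSpan-or-ternary n (T ∘ a ∘ suc) (T d) (λ i → T-ternary (a (suc i)) (ta (suc i))) (T-ternary d td)
    where
    T : Column K → Column K
    T = eliminate (a zero) κ (- a zero κ)
    T-ternary : ∀ f → AllSubsetSumsTernary f → AllSubsetSumsTernary (T f)
    T-ternary = eliminate-ternary (a zero) κ sgn (ta zero)
  ... | inj₁ (y , eq) = inj₁ ((λ { zero → y₀ ; (suc i) → y i }) , spans)
    where
    e = a zero
    m = - e κ
    w = combine y (a ∘ suc)
    y₀ = m * w κ - m * d κ
    spans : ∀ k → d k ≈ y₀ * e k + w k
    spans k = begin
      d k                                            ≈⟨ +-identityʳ _ ⟨
      d k + 0#                                       ≈⟨ +-congˡ (-‿inverseʳ (m * d κ * e k)) ⟨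
      d k + (m * d κ * e k - m * d κ * e k)          ≈⟨ +-assoc _ _ _ ⟨
      (d k + m * d κ * e k) - m * d κ * e k          ≈⟨ +-congʳ (trans (eq k) (eliminate-combine e κ m y (a ∘ suc) k)) ⟩
      (w k + m * w κ * e k) - m * d κ * e k          ≈⟨ +-congˡ (-‿distribˡ-* (m * d κ) (e k)) ⟩
      (w k + m * w κ * e k) + - (m * d κ) * e k      ≈⟨ solve 4 (λ w p q x → (w :+ p :* x) :+ q :* x :=
                                                                   (p :+ q) :* x :+ w) refl
                                                          (w k) (m * w κ) (- (m * d κ)) (e k) ⟩
      y₀ * e k + w k                                 ∎
  ... | inj₂ f = inj₂ λ t b tb (y , eq) →
    f t (eliminate e κ m b) (eliminate-ternary e κ sgn (ta zero) b tb) (y ∘ suc , reduced t b y eq)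
    where
    e = a zero
    m = - e κ
    reduced : ∀ t b y → (∀ k → t * d k + b k ≈ combine y a k) → ∀ k →
      t * eliminate e κ m d k + eliminate e κ m b k ≈ combine (y ∘ suc) (eliminate e κ m ∘ a ∘ suc) k
    reduced t b y eq k = begin
      t * (d k + m * d κ * e k) + (b k + m * b κ * e k)
        ≈⟨ solve 7 (λ t p q m x u v → t :* (p :+ m :* q :* x) :+ (u :+ m :* v :* x) :=
                       (t :* p :+ u) :+ m :* (t :* q :+ v) :* x) refl
             t (d k) (d κ) m (e k) (b k) (b κ) ⟩
      (t * d k + b k) + m * (t * d κ + b κ) * e k
        ≈⟨ +-cong (eq k) (*-congʳ (*-congˡ (eq κ))) ⟩
      (y zero * e k + w k) + m * (y zero * e κ + w κ) * e k
        ≈⟨ solve 6 (λ y x w m z v → (y :* x :+ w) :+ m :* (y :* z :+ v) :* x :=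
                       (y :* x :+ (m :* z) :* (y :* x)) :+ (w :+ m :* v :* x)) refl
             (y zero) (e k) (w k) m (e κ) (w κ) ⟩
      (y zero * e k + (m * e κ) * (y zero * e k)) + (w k + m * w κ * e k)
        ≈⟨ +-congʳ (+-congˡ (trans (*-congʳ (m*eκ≈-1 e κ sgn)) (-1*x≈-x _))) ⟩
      (y zero * e k - y zero * e k) + (w k + m * w κ * e k)
        ≈⟨ trans (+-congʳ (-‿inverseʳ _)) (+-identityˡ _) ⟩
      w k + m * w κ * e k
        ≈⟨ eliminate-combine e κ m (y ∘ suc) (a ∘ suc) k ⟨
      combine (y ∘ suc) (eliminate e κ m ∘ a ∘ suc) k ∎
      where w = combine (y ∘ suc) (a ∘ suc)

  combine-neg : ∀ {n K} (y : Fin n → Carrier) (a : Fin n → Column K) k →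
                combine (-_ ∘ y) a k ≈ - combine y a k
  combine-neg y a k = begin
    sum (λ i → - y i * a i k)         ≈⟨ sum-cong-≋ (λ i → begin
      - y i * a i k                     ≈⟨ -‿distribˡ-* (y i) (a i k) ⟨
      - (y i * a i k)                   ≈⟨ -1*x≈-x _ ⟨
      - 1# * (y i * a i k)              ∎) ⟩
    sum (λ i → - 1# * (y i * a i k))  ≈⟨ *-distribˡ-sum (- 1#) (λ i → y i * a i k) ⟨
    - 1# * combine y a k              ≈⟨ -1*x≈-x _ ⟩
    - combine y a k                   ∎

  combine-remove : ∀ {n K} (y : Fin (suc n) → Carrier) (a : Fin (suc n) → Column K) i k →
    combine y a k ≈ y i * a i k + combine (removeAt y i) (removeAt a i) k
  combine-remove y a i k = sum-remove λ i → y i * a i k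

  solution-ternary : ∀ {n K} (a : Fin (suc n) → Column K) (b : Column K) →
    (∀ i → AllSubsetSumsTernary (a i)) → AllSubsetSumsTernary b →
    (∀ z → (∀ k → combine z a k ≈ 0#) → ∀ i → z i ≈ 0#) →
    ∀ t → (∀ k → combine t a k + b k ≈ 0#) → ∀ i → Ternary (t i)
  solution-ternary {n} a b ta tb kernel t eq i
    with inSpan-or-ternary n (removeAt a i) (a i) (ta ∘ punchIn i) (ta i)
  ... | inj₂ f = f (t i) b tb (-_ ∘ removeAt t i , λ k → begin
      t i * a i k + b k
        ≈⟨ +-inverseˡ-unique _ (w k) (begin
          (t i * a i k + b k) + w k    ≈⟨ solve 3 (λ x y z → (x :+ y) :+ z := (x :+ z) :+ y) refl _ _ _ ⟩
          (t i * a i k + w k) + b k    ≈⟨ +-congʳ (combine-remove t a i k) ⟨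
          combine t a k + b k          ≈⟨ eq k ⟩
          0#                           ∎) ⟩
      - w k
        ≈⟨ combine-neg (removeAt t i) (removeAt a i) k ⟨
      combine (-_ ∘ removeAt t i) (removeAt a i) k ∎)
    where w = combine (removeAt t i) (removeAt a i)
  ... | inj₁ (y , spans) = ⊥-elim (1≉0 (trans (reflexive (≡.sym zᵢ≡1)) (kernel z vanishes i)))
    where
    z = insertAt (-_ ∘ y) i 1#
    zᵢ≡1 : z i ≡ 1#
    zᵢ≡1 = insertAt-lookup (-_ ∘ y) i 1#
    vanishes : ∀ k → combine z a k ≈ 0#
    vanishes k = begin
      combine z a k
        ≈⟨ combine-remove z a i k ⟩
      z i * a i k + combine (removeAt z i) (removeAt a i) k
        ≈⟨ +-cong (trans (*-congʳ (reflexive zᵢ≡1)) (*-identityˡ _))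
                  (sum-cong-≋ λ j → *-congʳ (reflexive (insertAt-punchIn (-_ ∘ y) i 1# j))) ⟩
      a i k + combine (-_ ∘ y) (removeAt a i) k
        ≈⟨ +-cong (spans k) (combine-neg y (removeAt a i) k) ⟩
      combine y (removeAt a i) k - combine y (removeAt a i) k
        ≈⟨ -‿inverseʳ _ ⟩
      0# ∎

  module _ {μ ℓμ} (M : Module R μ ℓμ) where

    open Module M
    private
      module Mon = CommutativeMonoidSum +ᴹ-commutativeMonoid

    linearCombination : ∀ {n} → (Fin n → Carrier) → (Fin n → Carrierᴹ) → Carrierᴹ
    linearCombination r v = Mon.sum λ i → r i *ₗ v i

    linearCombination-cong : ∀ {n} (r s : Fin n → Carrier) (v w : Fin n → Carrierᴹ) →
      (∀ i → r i ≈ s i) → (∀ i → v i ≈ᴹ w i) →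
      linearCombination r v ≈ᴹ linearCombination s w
    linearCombination-cong r s v w r≈s v≈w = Mon.sum-cong-≋ λ i → *ₗ-cong (r≈s i) (v≈w i)

    linearCombination-+ : ∀ {n} (r s : Fin n → Carrier) (v : Fin n → Carrierᴹ) →
      linearCombination (λ i → r i + s i) v ≈ᴹ linearCombination r v +ᴹ linearCombination s v
    linearCombination-+ r s v = ≈ᴹ-trans
      (Mon.sum-cong-≋ λ i → *ₗ-distribʳ (v i) (r i) (s i))
      (Mon.∑-distrib-+ (λ i → r i *ₗ v i) (λ i → s i *ₗ v i))

    linearCombination-* : ∀ {n} c (r : Fin n → Carrier) (v : Fin n → Carrierᴹ) →
      linearCombination (λ i → c * r i) v ≈ᴹ c *ₗ linearCombination r v
    linearCombination-* {ℕ.zero} c r v = ≈ᴹ-sym (*ₗ-zeroʳ c)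
    linearCombination-* {suc n}  c r v = ≈ᴹ-trans
      (+ᴹ-cong (*ₗ-assoc c (r zero) (v zero)) (linearCombination-* c (r ∘ suc) (v ∘ suc)))
      (≈ᴹ-sym (*ₗ-distribˡ c _ _))

    linearCombination-zero : ∀ {n} {r : Fin n → Carrier} (v : Fin n → Carrierᴹ) →
      (∀ i → r i ≈ 0#) → linearCombination r v ≈ᴹ 0ᴹ
    linearCombination-zero {ℕ.zero} v r≈0 = ≈ᴹ-refl
    linearCombination-zero {suc n}  v r≈0 = ≈ᴹ-trans
      (+ᴹ-cong (SemimoduleProperties.x≈0⇒x*y≈0 semimodule (r≈0 zero))
               (linearCombination-zero (v ∘ suc) (r≈0 ∘ suc)))
      (+ᴹ-identityˡ 0ᴹ)

    linearCombination-comp : ∀ {n J} (r : Fin n → Carrier) (c : Fin n → Fin J → Carrier)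
      (v : Fin J → Carrierᴹ) →
      linearCombination r (λ i → linearCombination (c i) v) ≈ᴹ
      linearCombination (combine r c) v
    linearCombination-comp {ℕ.zero} r c v = ≈ᴹ-sym (linearCombination-zero v λ _ → refl)
    linearCombination-comp {suc n}  r c v = ≈ᴹ-sym (≈ᴹ-trans
      (linearCombination-+ (λ j → r zero * c zero j) (combine (r ∘ suc) (c ∘ suc)) v)
      (+ᴹ-cong (linearCombination-* (r zero) (c zero) v)
               (≈ᴹ-sym (linearCombination-comp (r ∘ suc) (c ∘ suc) v))))

    module _ {n K J} (a : Fin (suc n) → Column K) (b : Fin (suc J) → Column K)
      (v : Fin (suc J) → Carrierᴹ)
      (independent : ∀ r → linearCombination r v ≈ᴹ 0ᴹ → ∀ j → r j ≈ 0#) where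

      Solves : (Fin (suc n) → Carrierᴹ) → Set _
      Solves x = ∀ k → linearCombination (λ i → a i k) x +ᴹ
                       linearCombination (λ j → b j k) v ≈ᴹ 0ᴹ

      coordinates : (Fin (suc n) → Fin (suc J) → Carrier) → Fin (suc n) → Carrierᴹ
      coordinates c i = linearCombination (c i) v

      residual : ∀ c k →
        linearCombination (λ i → a i k) (coordinates c) +ᴹ linearCombination (λ j → b j k) v ≈ᴹ
        linearCombination (λ j → combine (λ i → c i j) a k + b j k) v
      residual c k = ≈ᴹ-sym (≈ᴹ-trans
        (linearCombination-+ (λ j → combine (λ i → c i j) a k) (λ j → b j k) v)
        (+ᴹ-congʳ (≈ᴹ-sym (≈ᴹ-trans (linearCombination-comp (λ i → a i k) c v)
          (linearCombination-cong (combine (λ i → a i k) c) (λ j → combine (λ i → c i j) a k) v v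
            (λ j → sum-cong-≋ λ i → *-comm (a i k) (c i j)) λ _ → ≈ᴹ-refl)))))

      coordinates-ternary :
        (∀ i → AllSubsetSumsTernary (a i)) → (∀ j → AllSubsetSumsTernary (b j)) →
        ∀ (u : Fin (suc n) → Carrierᴹ) → (∀ y → Solves y → ∀ i → u i ≈ᴹ y i) →
        ∀ x → Solves x → ∀ c → (∀ i → x i ≈ᴹ coordinates c i) →
        ∀ i j → Ternary (c i j)
      coordinates-ternary ta tb u unique x x-solves c x≈c i j =
        solution-ternary a (b j) ta (tb j) kernel (λ i → c i j) (λ k → scalar k j) i
        where
        c-solves : Solves (coordinates c)
        c-solves k = ≈ᴹ-trans
          (+ᴹ-congʳ (linearCombination-cong (λ i → a i k) (λ i → a i k) (coordinates c) x
                       (λ _ → refl) (≈ᴹ-sym ∘ x≈c)))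
          (x-solves k)
        scalar : ∀ k j → combine (λ i → c i j) a k + b j k ≈ 0#
        scalar k = independent _ (≈ᴹ-trans (≈ᴹ-sym (residual c k)) (c-solves k))

        -- A kernel vector z gives a second solution, by adding z i to every
        -- coordinate of x i.

        kernel : ∀ z → (∀ k → combine z a k ≈ 0#) → ∀ i → z i ≈ 0#
        kernel z za≈0 i = independent (λ _ → z i)
          (AbelianGroupProperties.identityʳ-unique +ᴹ-abelianGroup (coordinates c i) _
            (≈ᴹ-trans (≈ᴹ-sym (linearCombination-+ (c i) (λ _ → z i) v))
                      (≈ᴹ-trans (≈ᴹ-sym (unique (coordinates c′) solves′ i))
                                (unique (coordinates c) c-solves i))))
          zero
          where
          c′ : Fin (suc n) → Fin (suc J) → Carrier
          c′ i j = c i j + z i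
          scalar′ : ∀ k j → combine (λ i → c′ i j) a k + b j k ≈ 0#
          scalar′ k j = begin
            combine (λ i → c i j + z i) a k + b j k
              ≈⟨ +-congʳ (trans (sum-cong-≋ λ i → distribʳ (a i k) (c i j) (z i))
                                (∑-distrib-+ (λ i → c i j * a i k) (λ i → z i * a i k))) ⟩
            (combine (λ i → c i j) a k + combine z a k) + b j k
              ≈⟨ +-congʳ (trans (+-congˡ (za≈0 k)) (+-identityʳ _)) ⟩
            combine (λ i → c i j) a k + b j k
              ≈⟨ scalar k j ⟩
            0# ∎
          solves′ : Solves (coordinates c′)
          solves′ k = ≈ᴹ-trans (residual c′ k) (linearCombination-zero v (scalar′ k))

open import Defs

fromℚ-≉0 : ∀ q {_ : False (ℚ.∣ q ℚ.- 0ℚ ∣ ℚ.<? 1ℚ)} → ¬ fromℚ q ≈ 0ℝ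
fromℚ-≉0 q {q≮1} q≈0 = toWitnessFalse q≮1 (proj₂ bound (proj₁ bound) ℕ.≤-refl)
  where bound = q≈0 1ℚ (ℚ.positive⁻¹ 1ℚ)

module ℝSums = SubsetSums ℝ-commutativeRing
  (fromℚ-≉0 (1ℚ ℚ.+ 1ℚ) , fromℚ-≉0 (1ℚ ℚ.+ 1ℚ ℚ.+ 1ℚ))

lemma4p5 : (p : ℕ) → Prime p →
    (g : ℕ) → IsGenus p g →
    (v : Fin (suc (2 ℕ.* g)) → Module.Carrierᴹ (V p)) → IsBasis (V p) v →
    (n K : ℕ) →
    (a : Fin (suc n) → Fin (suc K) → ℝ) →
    (b : Fin (suc (2 ℕ.* g)) → Fin (suc K) → ℝ) →
    ∃! (λ x y → ∀ i → Module._≈ᴹ_ (V p) (x i) (y i)) (IsSolution {p} v a b) →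
    (∀ (A : Subset (suc K)) →
    (∀ i → InMinusOneZeroOne (subsetSum A (a i))) ×
    (∀ j → InMinusOneZeroOne (subsetSum A (b j)))) →
    (x : Fin (suc n) → Module.Carrierᴹ (V p)) → IsSolution {p} v a b x →
    ∃ λ (c : Fin (suc n) → Fin (suc (2 ℕ.* g)) → ℝ) →
    ∀ i → (∀ j → InMinusOneZeroOne (c i j)) ×
    Module._≈ᴹ_ (V p) (x i) (linearCombination (V p) (c i) v)
lemma4p5 p _ g _ v basis n K a b (u , _ , unique) sums x solves =
  c , λ i → ternary i , proj₂ (spanning (x i))
  where
  open IsBasis basis
  c : Fin (suc n) → Fin (suc (2 ℕ.* g)) → ℝ
  c i = proj₁ (spanning (x i))
  ternary : ∀ i j → InMinusOneZeroOne (c i j)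
  ternary = ℝSums.coordinates-ternary (V p) a b v independent
    (λ i A → proj₁ (sums A) i) (λ j A → proj₂ (sums A) j)
    u (λ y y-solves → unique {y} y-solves) x solves c (λ i → proj₂ (spanning (x i)))
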